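{- Let $a,c$ be positive integers and $h\ge a$ an integer. Consider directed walks with jumps $-a$ and $+c$ starting at altitude $h$ and staying at altitude $\ge0$ at all times (meanders). For $0\le i\le a-1$ let $F_i(z)=\sum_{n\ge0}f_{n,i}z^n$, where $f_{n,i}$ is the number of such walks with $n$ jumps ending at altitude $i$. Let $u_1(z),\dots,u_a(z)$ be the small roots of the kernel equation $1-zP(u)=0$, where $P(u)=u^{ -a}+u^c$. Then for each $i=0,\dots,a-1$, $$F_i(z)=\frac{(-1)^{a-i-1}}{z}\,s_{(h+1,\,1^{a-i-1},\,0^{i})}\bigl(u_1(z),\dots,u_a(z)\bigr).$$
   Context: The small roots of $1-zP(u)=0$, equivalently $u^a=z(1+u^{a+c})$, are the $a$ solutions $u(z)$ (Puiseux series at $z=0$) that tend to $0$ as $z\to0$. For an integer partition $\lambda=(\lambda_1\ge\dots\ge\lambda_a\ge0)$, $s_\lambda(x_1,\dots,x_a)=\det\bigl(x_i^{\lambda_j+a-j}\bigr)_{1\le i,j\le a}\big/\det\bigl(x_i^{a-j}\bigr)_{1\le i,j\le a}$ is the Schur polynomial in $a$ variables. The notation $1^{m}$ (resp. $0^m$) denotes $m$ repetitions of the part $1$ (resp. $0$). -}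

module Defs where

open import Algebra.Apartness.Bundles using (HeytingField; HeytingCommutativeRing)
open import Algebra.Bundles using (CommutativeRing; CommutativeMonoid; Semiring)
open import Algebra.Structures using (IsCommutativeRing)
import Algebra.Definitions.RawMonoid as RawMonoidDefs
import Algebra.Definitions.RawSemiring as RawSemiringDefs
import Algebra.Properties.CommutativeSemigroup as CommutativeSemigroupProperties
open import Data.Bool.Base using (if_then_else_)
open import Data.Fin.Base as Fin using (Fin; zero; suc; toℕ; punchIn)
import Data.Integer.Base as ℤ
import Data.Integer.Properties as ℤₚ
open import Data.Integer.Base using (ℤ; +_)
open import Data.List.Base as List using (List; []; _∷_)
open import Data.Nat.Base as ℕ using (ℕ; zero; suc; _∸_; _≤_; z≤n; s≤s; NonZero)
open import Data.Nat.Divisibility using (_∣?_)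
open import Data.Nat.DivMod using (_/_)
open import Data.Nat.Properties using (≤-refl)
open import Data.Product.Base using (_×_; _,_; ∃-syntax)
open import Data.Vec.Base using (Vec; []; _∷_)
open import Data.Vec.Functional using (Vector)
open import Data.Vec.Relation.Unary.All using (All; all?)
open import Level using (Level; _⊔_)
open import Relation.Binary.PropositionalEquality.Core using (_≡_; _≢_)
open import Relation.Nullary.Decidable using (Dec; does; _×-dec_)

private
  variable
    n : ℕ

------------------------------------------------------------------------
-- Directed walks with jumps -a and +c

data Jump : Set where
  down up : Jump

module Walks (a c : ℕ) where

  jump : Jump → ℤ
  jump down = ℤ.- (+ a)
  jump up   = + c

  altitudes : ℤ → Vec Jump n → Vec ℤ (suc n)
  altitudes k []      = k ∷ []
  altitudes k (j ∷ w) = k ∷ altitudes (k ℤ.+ jump j) w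

  final : ℤ → Vec Jump n → ℤ
  final k []      = k
  final k (j ∷ w) = final (k ℤ.+ jump j) w

  MeanderTo : (h i : ℕ) → Vec Jump n → Set
  MeanderTo h i w = All (+ 0 ℤ.≤_) (altitudes (+ h) w) × final (+ h) w ≡ + i

  meanderTo? : ∀ h i (w : Vec Jump n) → Dec (MeanderTo h i w)
  meanderTo? h i w =
    all? (+ 0 ℤₚ.≤?_) (altitudes (+ h) w) ×-dec (final (+ h) w ℤₚ.≟ + i)

  allWalks : ∀ n → List (Vec Jump n)
  allWalks zero    = [] ∷ []
  allWalks (suc n) =
    List.map (down ∷_) (allWalks n) List.++ List.map (up ∷_) (allWalks n)

  #meanders : (h i n : ℕ) → ℕ
  #meanders h i n = List.length (List.filter (meanderTo? h i) (allWalks n))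

------------------------------------------------------------------------
-- Integer partitions with at most a parts, padded with zeros

record Partition (a : ℕ) : Set where
  field
    part       : Vector ℕ a
    decreasing : ∀ {j k} → j Fin.≤ k → part k ≤ part j

infixl 9 _‼_

_‼_ : List ℕ → ℕ → ℕ
[]       ‼ _     = 0
(x ∷ _)  ‼ zero  = x
(_ ∷ xs) ‼ suc k = xs ‼ k

private
  tailParts : (m i : ℕ) → List ℕ
  tailParts m i = List.replicate m 1 List.++ List.replicate i 0

  zeros-‼ : ∀ i k → List.replicate i 0 ‼ k ≤ 0
  zeros-‼ zero    k       = z≤n
  zeros-‼ (suc i) zero    = z≤n
  zeros-‼ (suc i) (suc k) = zeros-‼ i k

  tailParts-≤1 : ∀ m i k → tailParts m i ‼ k ≤ 1
  tailParts-≤1 zero    i k       = lemma (zeros-‼ i k)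
    where
    lemma : ∀ {x} → x ≤ 0 → x ≤ 1
    lemma z≤n = z≤n
  tailParts-≤1 (suc m) i zero    = s≤s z≤n
  tailParts-≤1 (suc m) i (suc k) = tailParts-≤1 m i k

  tailParts-decreasing : ∀ m i {j k} → j ≤ k →
                         tailParts m i ‼ k ≤ tailParts m i ‼ j
  tailParts-decreasing zero    i {j} {k} _ with tailParts 0 i ‼ k | zeros-‼ i k
  ... | .0 | z≤n = z≤n
  tailParts-decreasing (suc m) i {k = k} z≤n      = tailParts-≤1 (suc m) i k
  tailParts-decreasing (suc m) i         (s≤s le) = tailParts-decreasing m i le

  hook-decreasing : ∀ h m i {j k} → j ≤ k →
                    (suc h ∷ tailParts m i) ‼ k ≤ (suc h ∷ tailParts m i) ‼ j
  hook-decreasing h m i {k = zero}  z≤n      = ≤-refl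
  hook-decreasing h m i {k = suc k} z≤n with tailParts m i ‼ k | tailParts-≤1 m i k
  ... | .0 | z≤n     = z≤n
  ... | .1 | s≤s z≤n = s≤s z≤n
  hook-decreasing h m i             (s≤s le) = tailParts-decreasing m i le

-- (h+1, 1^{a-i-1}, 0^i).  The list below has length exactly a, so the default
-- value of _‼_ is never reached.
hook : ∀ {a} (h : ℕ) (i : Fin a) → Partition a
hook {a} h i = record
  { part       = λ j → (suc h ∷ ones List.++ zeros) ‼ toℕ j
  ; decreasing = hook-decreasing h (a ∸ toℕ i ∸ 1) (toℕ i)
  }
  where
  ones zeros : List ℕ
  ones  = List.replicate (a ∸ toℕ i ∸ 1) 1
  zeros = List.replicate (toℕ i) 0

------------------------------------------------------------------------
-- Determinants

module Determinant {r ℓ} (R : CommutativeRing r ℓ) where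
  open CommutativeRing R hiding (zero)
  open RawSemiringDefs (Semiring.rawSemiring (CommutativeRing.semiring R)) using (_^_; sum)

  Matrix : ℕ → Set r
  Matrix n = Fin n → Fin n → Carrier

  det : Matrix n → Carrier
  det {zero}  M = 1#
  det {suc n} M = sum λ j →
    (- 1#) ^ toℕ j * (M zero j * det (λ i k → M (suc i) (punchIn j k)))

  -- (x_i ^ e_j)_{i,j}
  powers : Vector Carrier n → Vector ℕ n → Matrix n
  powers x e i j = x i ^ e j

------------------------------------------------------------------------
-- The ring R[[t]]

module PowerSeries {r ℓ} (R : CommutativeRing r ℓ) where
  open CommutativeRing R hiding (zero)
  open RawSemiringDefs (Semiring.rawSemiring (CommutativeRing.semiring R)) using (sum)
  open import Relation.Binary.Reasoning.Setoid setoid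
  private
    module +S = CommutativeSemigroupProperties +-commutativeSemigroup

  infix  4 _≈ₛ_
  infixl 6 _+ₛ_
  infixl 7 _*ₛ_
  infix  8 -ₛ_

  Series : Set r
  Series = ℕ → Carrier

  _≈ₛ_ : Series → Series → Set ℓ
  f ≈ₛ g = ∀ n → f n ≈ g n

  _+ₛ_ _*ₛ_ : Series → Series → Series
  (f +ₛ g) n = f n + g n
  (f *ₛ g) n = sum {suc n} λ k → f (toℕ k) * g (n ∸ toℕ k)

  -ₛ_ : Series → Series
  (-ₛ f) n = - f n

  0ₛ 1ₛ t : Series
  0ₛ _ = 0#

  1ₛ zero    = 1#
  1ₛ (suc _) = 0#

  t zero    = 0#
  t (suc n) = 1ₛ n

  private
    tl : Series → Series
    tl f n = f (suc n)

    _·_ : Carrier → Series → Series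
    (x · f) n = x * f n

    *-congₛ : ∀ {f f′ g g′} → f ≈ₛ f′ → g ≈ₛ g′ → f *ₛ g ≈ₛ f′ *ₛ g′
    *-congₛ p q zero    = +-congʳ (*-cong (p 0) (q 0))
    *-congₛ p q (suc n) =
      +-cong (*-cong (p 0) (q (suc n))) (*-congₛ (λ k → p (suc k)) q n)

    distribʳₛ : ∀ h f g → (f +ₛ g) *ₛ h ≈ₛ (f *ₛ h) +ₛ (g *ₛ h)
    distribʳₛ h f g zero    = begin
      (f 0 + g 0) * h 0 + 0#            ≈⟨ +-identityʳ _ ⟩
      (f 0 + g 0) * h 0                 ≈⟨ distribʳ _ _ _ ⟩
      f 0 * h 0 + g 0 * h 0             ≈⟨ +-cong (+-identityʳ _) (+-identityʳ _) ⟨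
      (f 0 * h 0 + 0#) + (g 0 * h 0 + 0#) ∎
    distribʳₛ h f g (suc n) = begin
      (f 0 + g 0) * h (suc n) + ((tl f +ₛ tl g) *ₛ h) n
        ≈⟨ +-cong (distribʳ _ _ _) (distribʳₛ h (tl f) (tl g) n) ⟩
      (f 0 * h (suc n) + g 0 * h (suc n)) + ((tl f *ₛ h) n + (tl g *ₛ h) n)
        ≈⟨ +S.interchange _ _ _ _ ⟩
      (f *ₛ h) (suc n) + (g *ₛ h) (suc n) ∎

    ·-*ₛ : ∀ x f g → (x · f) *ₛ g ≈ₛ x · (f *ₛ g)
    ·-*ₛ x f g zero    = begin
      x * f 0 * g 0 + 0#     ≈⟨ +-identityʳ _ ⟩
      x * f 0 * g 0          ≈⟨ *-assoc _ _ _ ⟩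
      x * (f 0 * g 0)        ≈⟨ *-congˡ (+-identityʳ _) ⟨
      x * (f 0 * g 0 + 0#)   ∎
    ·-*ₛ x f g (suc n) = begin
      x * f 0 * g (suc n) + ((x · tl f) *ₛ g) n
        ≈⟨ +-cong (*-assoc _ _ _) (·-*ₛ x (tl f) g n) ⟩
      x * (f 0 * g (suc n)) + x * (tl f *ₛ g) n
        ≈⟨ distribˡ _ _ _ ⟨
      x * (f *ₛ g) (suc n) ∎

    assocₛ : ∀ f g h → (f *ₛ g) *ₛ h ≈ₛ f *ₛ (g *ₛ h)
    assocₛ f g h zero    = begin
      (f 0 * g 0 + 0#) * h 0 + 0#    ≈⟨ +-congʳ (*-congʳ (+-identityʳ _)) ⟩
      f 0 * g 0 * h 0 + 0#           ≈⟨ +-congʳ (*-assoc _ _ _) ⟩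
      f 0 * (g 0 * h 0) + 0#         ≈⟨ +-congʳ (*-congˡ (+-identityʳ _)) ⟨
      f 0 * (g 0 * h 0 + 0#) + 0#    ∎
    assocₛ f g h (suc n) = begin
      (f 0 * g 0 + 0#) * h (suc n) + (((f 0 · tl g) +ₛ (tl f *ₛ g)) *ₛ h) n
        ≈⟨ +-cong (trans (*-congʳ (+-identityʳ _)) (*-assoc _ _ _))
                  (distribʳₛ h (f 0 · tl g) (tl f *ₛ g) n) ⟩
      f 0 * (g 0 * h (suc n)) + (((f 0 · tl g) *ₛ h) n + ((tl f *ₛ g) *ₛ h) n)
        ≈⟨ +-congˡ (+-cong (·-*ₛ (f 0) (tl g) h n) (assocₛ (tl f) g h n)) ⟩
      f 0 * (g 0 * h (suc n)) + (f 0 * (tl g *ₛ h) n + (tl f *ₛ (g *ₛ h)) n)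
        ≈⟨ +-assoc _ _ _ ⟨
      (f 0 * (g 0 * h (suc n)) + f 0 * (tl g *ₛ h) n) + (tl f *ₛ (g *ₛ h)) n
        ≈⟨ +-congʳ (distribˡ _ _ _) ⟨
      (f *ₛ (g *ₛ h)) (suc n) ∎

    *ₛ-lastTerm : ∀ f g n → (f *ₛ g) (suc n) ≈ f (suc n) * g 0 + (f *ₛ tl g) n
    *ₛ-lastTerm f g zero    = begin
      f 0 * g 1 + (f 1 * g 0 + 0#)   ≈⟨ +S.x∙yz≈y∙xz _ _ _ ⟩
      f 1 * g 0 + (f 0 * g 1 + 0#)   ∎
    *ₛ-lastTerm f g (suc n) = begin
      f 0 * g (2 ℕ.+ n) + (tl f *ₛ g) (suc n)
        ≈⟨ +-congˡ (*ₛ-lastTerm (tl f) g n) ⟩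
      f 0 * g (2 ℕ.+ n) + (f (2 ℕ.+ n) * g 0 + (tl f *ₛ tl g) n)
        ≈⟨ +S.x∙yz≈y∙xz _ _ _ ⟩
      f (2 ℕ.+ n) * g 0 + (f *ₛ tl g) (suc n) ∎

    commₛ : ∀ f g → f *ₛ g ≈ₛ g *ₛ f
    commₛ f g zero    = +-congʳ (*-comm _ _)
    commₛ f g (suc n) = begin
      f 0 * g (suc n) + (tl f *ₛ g) n   ≈⟨ +-cong (*-comm _ _) (commₛ (tl f) g n) ⟩
      g (suc n) * f 0 + (g *ₛ tl f) n   ≈⟨ *ₛ-lastTerm g f n ⟨
      (g *ₛ f) (suc n)                  ∎

    zeroˡₛ : ∀ f → 0ₛ *ₛ f ≈ₛ 0ₛ
    zeroˡₛ f zero    = trans (+-identityʳ _) (zeroˡ _)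
    zeroˡₛ f (suc n) = trans (+-cong (zeroˡ _) (zeroˡₛ f n)) (+-identityʳ _)

    identityˡₛ : ∀ f → 1ₛ *ₛ f ≈ₛ f
    identityˡₛ f zero    = trans (+-identityʳ _) (*-identityˡ _)
    identityˡₛ f (suc n) = trans (+-cong (*-identityˡ _) (zeroˡₛ f n)) (+-identityʳ _)

  isCommutativeRingₛ : IsCommutativeRing _≈ₛ_ _+ₛ_ _*ₛ_ -ₛ_ 0ₛ 1ₛ
  isCommutativeRingₛ = record
    { isRing = record
      { +-isAbelianGroup = record
        { isGroup = record
          { isMonoid = record
            { isSemigroup = record
              { isMagma = record
                { isEquivalence = record
                  { refl  = λ _ → refl
                  ; sym   = λ p n → sym (p n)
                  ; trans = λ p q n → trans (p n) (q n)
                  }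
                ; ∙-cong = λ p q n → +-cong (p n) (q n)
                }
              ; assoc = λ _ _ _ _ → +-assoc _ _ _
              }
            ; identity = (λ _ _ → +-identityˡ _) , (λ _ _ → +-identityʳ _)
            }
          ; inverse = (λ _ _ → -‿inverseˡ _) , (λ _ _ → -‿inverseʳ _)
          ; ⁻¹-cong = λ p n → -‿cong (p n)
          }
        ; comm = λ _ _ _ → +-comm _ _
        }
      ; *-cong     = *-congₛ
      ; *-assoc    = assocₛ
      ; *-identity = identityˡₛ
                   , (λ f n → trans (commₛ f 1ₛ n) (identityˡₛ f n))
      ; distrib    =
          (λ f g h n → trans (commₛ f (g +ₛ h) n)
                       (trans (distribʳₛ f g h n)
                              (+-cong (commₛ g f n) (commₛ h f n))))
        , distribʳₛ
      }
    ; *-comm = commₛ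
    }

  seriesRing : CommutativeRing r ℓ
  seriesRing = record { isCommutativeRing = isCommutativeRingₛ }

------------------------------------------------------------------------
-- Puiseux series
--
-- Every finite family of Puiseux series in z over K, all of nonnegative
-- valuation, lies in K[[z^{1/N}]] for some common N ≥ 1.  This ring is
-- K[[t]] with z = t^N.  The field K plays the role of ℂ; being a Heyting field,
-- it is not required to have decidable equality.

module Puiseux {k ℓ₁ ℓ₂} (K : HeytingField k ℓ₁ ℓ₂) (N : ℕ) .{{_ : NonZero N}} where
  private
    module K = HeytingField K

    Kring : CommutativeRing k ℓ₁
    Kring = HeytingCommutativeRing.commutativeRing K.heytingCommutativeRing

  open PowerSeries Kring public using (Series; t; seriesRing)
  open CommutativeRing seriesRing public
    using (_≈_; _+_; _*_; -_; 0#; 1#)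
  open RawSemiringDefs (Semiring.rawSemiring (CommutativeRing.semiring seriesRing)) public using (_^_)
  open Determinant seriesRing using (det; powers)

  infix 4 _#_ _≈_÷_

  -- Positive form of f ≠ g.
  _#_ : Series → Series → Set ℓ₂
  f # g = ∃[ n ] f n K.# g n

  -- f = g / d in the fraction field of the domain K[[t]].
  _≈_÷_ : Series → Series → Series → Set (ℓ₁ ⊔ ℓ₂)
  f ≈ g ÷ d = d # 0# × f * d ≈ g

  z : Series
  z = t ^ N

  -- The image of Σ fₙ zⁿ, with fₙ ∈ ℕ.
  generatingFunction : (ℕ → ℕ) → Series
  generatingFunction f n = if does (N ∣? n) then f (n / N) · K.1# else K.0#
    where open RawMonoidDefs (CommutativeMonoid.rawMonoid (CommutativeRing.+-commutativeMonoid Kring)) renaming (_×_ to _·_)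

  -- s is the value at x of the Schur polynomial s_λ in a variables.  With
  -- 0-based indices j, the exponents are λ_j + (a - 1 - j).
  IsSchur : ∀ {a} → Partition a → Vector Series a → Series → Set (ℓ₁ ⊔ ℓ₂)
  IsSchur {a} λ′ x s =
    s ≈ det (powers x (λ j → part j ℕ.+ (a ∸ 1 ∸ toℕ j)))
      ÷ det (powers x (λ j → a ∸ 1 ∸ toℕ j))
    where open Partition λ′

  -- As 1 - zP(u) = 0 has no more than a small roots, a pairwise distinct family of a
  -- of them is a complete list.  Tending to 0 as z → 0 means having no
  -- constant term.
  record SmallRoots (a c : ℕ) (u : Vector Series a) : Set (ℓ₁ ⊔ ℓ₂) where
    field
      small    : ∀ j → u j 0 K.≈ K.0#
      kernel   : ∀ j → u j ^ a ≈ z * (1# + u j ^ (a ℕ.+ c))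
      distinct : ∀ {i j} → i ≢ j → u i # u j

  meanderGF : (a c h i : ℕ) → Series
  meanderGF a c h i = generatingFunction (#meanders h i)
    where open Walks a c

{-# OPTIONS --safe #-}

-- Kernel method.  Decomposing a walk by its first jump shows that the truncated
-- generating function S(h) = Σ_{e<a} F_{h,e} u^e of the meanders from altitude h obeys
-- S(h) = [h<a] u^h + z ([h≥a] S(h-a) + S(h+c)), while the kernel equation reads
-- u^(h+a) = z (u^h + u^(h+c+a)).  So z S(h) and u^(h+a) satisfy the same contracting
-- recursion, and z S(h) = u^(h+a) at every root u of the kernel.  At the a roots this is
-- a linear system for the z F_{h,e} whose matrix is the Vandermonde matrix, and in
-- Cramer's rule the column u^(h+a), moved to the front with sign (-1)^(a-i-1), makes
-- the numerator the alternant of the hook partition.  The Vandermonde determinant is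
-- nonzero since K[[t]] is a domain.

module Submission where

open import Defs
open import Algebra.Apartness.Bundles using (HeytingField; HeytingCommutativeRing)
import Algebra.Apartness.Properties.HeytingCommutativeRing as HeytingProperties
open import Algebra.Bundles using (CommutativeMonoid; CommutativeRing; Semiring)
import Algebra.Definitions.RawSemiring as RawSemiringDefs
import Algebra.Properties.CommutativeMonoid.Sum as MonoidSum
import Algebra.Properties.CommutativeSemigroup as CommutativeSemigroupProperties
import Algebra.Properties.Monoid.Mult as MonoidMult
import Algebra.Properties.Ring as RingProperties
import Algebra.Properties.Semiring.Exp as SemiringExp
import Algebra.Properties.Semiring.Sum as SemiringSum
open import Data.Bool.Base using (true; false)
open import Data.Fin.Base using (Fin; zero; suc; toℕ; inject₁; punchIn; punchOut; opposite; fromℕ<)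
open import Data.Fin.Induction using (<-weakInduction)
open import Data.Fin.Permutation as Perm using (Permutation′; _⟨$⟩ʳ_)
open import Data.Fin.Properties as Finₚ
  using (toℕ<n; toℕ-fromℕ<; toℕ-inject₁; suc-injective; punchInᵢ≢i; punchIn-punchOut;
         opposite-prop; opposite-involutive)
open import Data.Integer.Base as ℤ using (ℤ; +_)
import Data.Integer.Properties as ℤₚ
open import Data.List.Base using (List; []; _∷_; length; filter; map; replicate; _++_)
open import Data.List.Properties
  using (filter-++; length-++; filter-accept; filter-reject; filter-none)
import Data.List.Relation.Unary.All as All
import Data.List.Relation.Unary.All.Properties as Allₚ
open import Data.Nat.Base as ℕ
  using (ℕ; zero; suc; NonZero; _≤_; _<_; _∸_; z≤n; s≤s; >-nonZero⁻¹)
open import Data.Nat.Divisibility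
  using (_∣?_; _∣0; ∣-refl; ∣m∣n⇒∣m+n; ∣m+n∣m⇒∣n; >⇒∤)
open import Data.Nat.DivMod using (_/_; 0/n≡0; n/n≡1; +-distrib-/-∣ˡ)
open import Data.Nat.Induction using (<-wellFounded)
import Data.Nat.Properties as ℕₚ
open import Data.Product.Base as Prod using (Σ-syntax; ∃-syntax; _×_; _,_; proj₂)
open import Data.Sum.Base as Sum using (_⊎_; inj₁; inj₂)
open import Data.Vec.Base using (Vec; []; _∷_)
open import Data.Vec.Functional as Vector using (Vector; head; tail; insertAt; removeAt)
open import Data.Vec.Functional.Properties using (insertAt-lookup; insertAt-punchIn)
open import Data.Vec.Relation.Unary.All using (All; []; _∷_)
open import Function.Base using (_∘_; id)
open import Function.Bundles using (_⇔_; mk⇔; Equivalence)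
open import Induction.WellFounded using (Acc; acc)
open import Relation.Binary.Definitions using (tri<; tri≈; tri>)
open import Relation.Binary.PropositionalEquality as ≡ using (_≡_; _≢_)
open import Relation.Nullary.Decidable using (does; yes; no; dec-true; dec-false; does-⇔)
open import Relation.Nullary.Negation using (¬_; contradiction)
open import Relation.Unary using (Pred; Decidable)

private
  variable
    n : ℕ

-- Determinants

swapAdjacent : Fin n → Permutation′ (suc n)
swapAdjacent zero    = Perm.swap Perm.id
swapAdjacent (suc q) = Perm.lift₀ (swapAdjacent q)

-- Precomposing rows with `cycle p` brings column `p` to the front and keeps the order of the
-- others.
cycle : Fin (suc n) → Fin (suc n) → Fin (suc n)
cycle p zero    = p
cycle p (suc k) = punchIn p k

swapAdjacent-inject₁ : (q : Fin n) → swapAdjacent q ⟨$⟩ʳ inject₁ q ≡ suc q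
swapAdjacent-inject₁ zero    = ≡.refl
swapAdjacent-inject₁ (suc q) = ≡.cong suc (swapAdjacent-inject₁ q)

swapAdjacent-suc : (q : Fin n) → swapAdjacent q ⟨$⟩ʳ suc q ≡ inject₁ q
swapAdjacent-suc zero    = ≡.refl
swapAdjacent-suc (suc q) = ≡.cong suc (swapAdjacent-suc q)

swapAdjacent-punchIn-inject₁ : (q k : Fin n) →
                         swapAdjacent q ⟨$⟩ʳ punchIn (inject₁ q) k ≡ punchIn (suc q) k
swapAdjacent-punchIn-inject₁ zero    zero    = ≡.refl
swapAdjacent-punchIn-inject₁ zero    (suc k) = ≡.refl
swapAdjacent-punchIn-inject₁ (suc q) zero    = ≡.refl
swapAdjacent-punchIn-inject₁ (suc q) (suc k) = ≡.cong suc (swapAdjacent-punchIn-inject₁ q k)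

swapAdjacent-punchIn-suc : (q k : Fin n) →
                     swapAdjacent q ⟨$⟩ʳ punchIn (suc q) k ≡ punchIn (inject₁ q) k
swapAdjacent-punchIn-suc zero    zero    = ≡.refl
swapAdjacent-punchIn-suc zero    (suc k) = ≡.refl
swapAdjacent-punchIn-suc (suc q) zero    = ≡.refl
swapAdjacent-punchIn-suc (suc q) (suc k) = ≡.cong suc (swapAdjacent-punchIn-suc q k)

punchIn-inject₁ : (q : Fin n) → punchIn (inject₁ q) q ≡ suc q
punchIn-inject₁ zero    = ≡.refl
punchIn-inject₁ (suc q) = ≡.cong suc (punchIn-inject₁ q)

-- Minors deleting one or the other of two adjacent columns differ only in which of the two
-- survives, at one and the same position.
punchIn-adjacent : (q k : Fin n) → punchIn (suc q) k ≡ punchIn (inject₁ q) k ⊎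
                   punchIn (suc q) k ≡ inject₁ q × punchIn (inject₁ q) k ≡ suc q
punchIn-adjacent zero    zero    = inj₂ (≡.refl , ≡.refl)
punchIn-adjacent zero    (suc k) = inj₁ ≡.refl
punchIn-adjacent (suc q) zero    = inj₁ ≡.refl
punchIn-adjacent (suc q) (suc k) =
  Sum.map (≡.cong suc) (Prod.map (≡.cong suc) (≡.cong suc)) (punchIn-adjacent q k)

-- Each further place costs one adjacent transposition, hence one sign; this drives the induction in
-- `det-cycle`.
swapAdjacent-cycle : (q : Fin n) (k : Fin (suc n)) →
               swapAdjacent q ⟨$⟩ʳ cycle (inject₁ q) k ≡ cycle (suc q) k
swapAdjacent-cycle q zero    = swapAdjacent-inject₁ q
swapAdjacent-cycle q (suc k) = swapAdjacent-punchIn-inject₁ q k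

-- How the index j of a deleted column meets the adjacent pair (inject₁ q, suc q):
-- if it is neither of the two, they become the adjacent pair at q′ in the minor.
data Meets : ∀ {n} → Fin n → Fin (suc n) → Set where
  left  : {q : Fin n} → Meets q (inject₁ q)
  right : {q : Fin n} → Meets q (suc q)
  apart : {q : Fin (suc n)} {j : Fin (suc (suc n))} (q′ : Fin n) →
          punchIn j (inject₁ q′) ≡ inject₁ q → punchIn j (suc q′) ≡ suc q →
          swapAdjacent q ⟨$⟩ʳ j ≡ j →
          (∀ k → swapAdjacent q ⟨$⟩ʳ punchIn j k ≡ punchIn j (swapAdjacent q′ ⟨$⟩ʳ k)) →
          Meets q j

meets : (q : Fin n) (j : Fin (suc n)) → Meets q j
meets zero zero = left
meets zero (suc zero) = right
meets {suc (suc n)} zero (suc (suc j)) = apart zero ≡.refl ≡.refl ≡.refl λ where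
  zero          → ≡.refl
  (suc zero)    → ≡.refl
  (suc (suc k)) → ≡.refl
meets {suc (suc n)} (suc q) zero = apart q ≡.refl ≡.refl ≡.refl λ _ → ≡.refl
meets {suc (suc n)} (suc q) (suc j) with meets q j
... | left  = left
... | right = right
... | apart q′ l r s e =
  apart (suc q′) (≡.cong suc l) (≡.cong suc r) (≡.cong suc s) λ where
    zero    → ≡.refl
    (suc k) → ≡.cong suc (e k)

module SumProperties {m ℓ} (M : CommutativeMonoid m ℓ) where
  open CommutativeMonoid M
  open MonoidSum M

  sum-zero : ∀ {n} {t : Vector Carrier n} → (∀ j → t j ≈ ε) → sum t ≈ ε
  sum-zero {n} eq = trans (sum-cong-≋ eq) (sum-replicate-zero n)

  sum-single : (p : Fin n) (t : Vector Carrier n) → (∀ j → j ≢ p → t j ≈ ε) → sum t ≈ t p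
  sum-single {suc n} p t others = trans (sum-remove {i = p} t)
    (trans (∙-congˡ (sum-zero λ j → others (punchIn p j) (punchInᵢ≢i p j))) (identityʳ (t p)))

module DeterminantProperties {r ℓ} (R : CommutativeRing r ℓ) where
  open CommutativeRing R hiding (zero)
  open SemiringExp semiring using (_^_)
  open RawSemiringDefs (Semiring.rawSemiring semiring) using (product)
  open Determinant R
  open MonoidSum +-commutativeMonoid
  open SumProperties +-commutativeMonoid
  open SemiringSum semiring using (*-distribˡ-sum)
  open RingProperties ring using (-1*x≈-x; -‿distribˡ-*; -‿distribʳ-*; -‿involutive)
  open import Relation.Binary.Reasoning.Setoid setoid
  private module *S = CommutativeSemigroupProperties *-commutativeSemigroup

  minor : Matrix (suc n) → Fin (suc n) → Matrix n
  minor M j i k = M (suc i) (punchIn j k)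

  term : Matrix (suc n) → Fin (suc n) → Carrier
  term M j = (- 1#) ^ toℕ j * (M zero j * det (minor M j))

  det-cong : {M M′ : Matrix n} → (∀ i j → M i j ≈ M′ i j) → det M ≈ det M′
  det-cong {zero}  eq = refl
  det-cong {suc n} eq = sum-cong-≋ λ j →
    *-congˡ {x = (- 1#) ^ toℕ j} (*-cong (eq zero j) (det-cong λ i k → eq (suc i) (punchIn j k)))

  det-congʳ : ∀ {m} (M : Fin n → Fin m → Carrier) {f g : Fin n → Fin m} → (∀ k → f k ≡ g k) →
              det (λ i → M i ∘ f) ≈ det (λ i → M i ∘ g)
  det-congʳ M eq = det-cong λ i k → reflexive (≡.cong (M i) (eq k))

  sum-neg : (t : Vector Carrier n) → sum (λ j → - t j) ≈ - sum t
  sum-neg t = begin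
    sum (λ j → - t j)        ≈⟨ sum-cong-≋ (λ j → sym (-1*x≈-x (t j))) ⟩
    sum (λ j → - 1# * t j)   ≈⟨ *-distribˡ-sum (- 1#) t ⟨
    - 1# * sum t             ≈⟨ -1*x≈-x _ ⟩
    - sum t                  ∎

  -- Serves a first-row expansion in which only the terms at an adjacent pair of columns survive,
  -- and these cancel.
  sum-adjacent : (q : Fin n) (t : Vector Carrier (suc n)) → t (inject₁ q) + t (suc q) ≈ 0# →
                 (∀ j → j ≢ inject₁ q → j ≢ suc q → t j ≈ 0#) → sum t ≈ 0#
  sum-adjacent zero t pair others = begin
    t zero + (t (suc zero) + sum (tail (tail t)))
      ≈⟨ +-assoc _ _ _ ⟨
    (t zero + t (suc zero)) + sum (tail (tail t))
      ≈⟨ +-cong pair (sum-zero λ j → others (suc (suc j)) (λ ()) (λ ())) ⟩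
    0# + 0#
      ≈⟨ +-identityʳ 0# ⟩
    0# ∎
  sum-adjacent (suc q) t pair others = begin
    t zero + sum (tail t)
      ≈⟨ +-cong (others zero (λ ()) (λ ()))
                (sum-adjacent q (tail t) pair λ j j≢l j≢r →
                  others (suc j) (j≢l ∘ suc-injective) (j≢r ∘ suc-injective)) ⟩
    0# + 0#
      ≈⟨ +-identityʳ 0# ⟩
    0# ∎

  sign-suc : (q : Fin n) → (- 1#) ^ toℕ (suc q) ≈ - ((- 1#) ^ toℕ (inject₁ q))
  sign-suc q = trans (-1*x≈-x _) (-‿cong (reflexive (≡.cong ((- 1#) ^_) (≡.sym (toℕ-inject₁ q)))))

  -x*-y≈x*y : ∀ x y → - x * - y ≈ x * y
  -x*-y≈x*y x y = begin
    - x * - y       ≈⟨ -‿distribˡ-* x (- y) ⟨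
    - (x * - y)     ≈⟨ -‿cong (-‿distribʳ-* x y) ⟨
    - - (x * y)     ≈⟨ -‿involutive _ ⟩
    x * y           ∎

  sign-involutive : ∀ m x → (- 1#) ^ m * ((- 1#) ^ m * x) ≈ x
  sign-involutive zero    x = trans (*-identityˡ _) (*-identityˡ x)
  sign-involutive (suc m) x = begin
    - 1# * s * (- 1# * s * x)   ≈⟨ *-cong (-1*x≈-x s) (*-congʳ (-1*x≈-x s)) ⟩
    - s * (- s * x)             ≈⟨ *-congˡ (-‿distribˡ-* s x) ⟨
    - s * - (s * x)             ≈⟨ -x*-y≈x*y s (s * x) ⟩
    s * (s * x)                 ≈⟨ sign-involutive m x ⟩
    x                           ∎
    where s = (- 1#) ^ m

  -- Deleting either of the equal columns leaves the same minor, with opposite signs. Every other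
  -- minor still contains the pair, again adjacent, and vanishes by induction.
  det-adjacent-equal : (q : Fin n) (M : Matrix (suc n)) →
                       (∀ i → M i (inject₁ q) ≈ M i (suc q)) → det M ≈ 0#
  det-adjacent-equal q M eq = sum-adjacent q (term M) pair others
    where
    minor-eq : ∀ i k → minor M (suc q) i k ≈ minor M (inject₁ q) i k
    minor-eq i k with punchIn-adjacent q k
    ... | inj₁ same          = reflexive (≡.cong (M (suc i)) same)
    ... | inj₂ (atˡ , atʳ) = begin
      M (suc i) (punchIn (suc q) k)       ≡⟨ ≡.cong (M (suc i)) atˡ ⟩
      M (suc i) (inject₁ q)               ≈⟨ eq (suc i) ⟩
      M (suc i) (suc q)                   ≡⟨ ≡.cong (M (suc i)) atʳ ⟨
      M (suc i) (punchIn (inject₁ q) k)   ∎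

    pair : term M (inject₁ q) + term M (suc q) ≈ 0#
    pair = begin
      s * x + (- 1#) ^ toℕ (suc q) * y
        ≈⟨ +-congˡ (*-cong (sign-suc q) (*-cong (sym (eq zero)) (det-cong minor-eq))) ⟩
      s * x + - s * x
        ≈⟨ +-congˡ (-‿distribˡ-* _ _) ⟨
      s * x - s * x
        ≈⟨ -‿inverseʳ _ ⟩
      0# ∎
      where
      s = (- 1#) ^ toℕ (inject₁ q)
      x = M zero (inject₁ q) * det (minor M (inject₁ q))
      y = M zero (suc q) * det (minor M (suc q))

    others : ∀ j → j ≢ inject₁ q → j ≢ suc q → term M j ≈ 0#
    others j j≢l j≢r with meets q j
    ... | left  = contradiction ≡.refl j≢l
    ... | right = contradiction ≡.refl j≢r
    ... | apart q′ l r _ _ = begin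
      (- 1#) ^ toℕ j * (M zero j * det (minor M j))
        ≈⟨ *-congˡ (*-congˡ (det-adjacent-equal q′ (minor M j) λ i → begin
             M (suc i) (punchIn j (inject₁ q′)) ≡⟨ ≡.cong (M (suc i)) l ⟩
             M (suc i) (inject₁ q)              ≈⟨ eq (suc i) ⟩
             M (suc i) (suc q)                  ≡⟨ ≡.cong (M (suc i)) r ⟨
             M (suc i) (punchIn j (suc q′))     ∎)) ⟩
      (- 1#) ^ toℕ j * (M zero j * 0#)
        ≈⟨ *-congˡ (zeroʳ _) ⟩
      (- 1#) ^ toℕ j * 0#
        ≈⟨ zeroʳ _ ⟩
      0# ∎

  -- Reindex the first-row expansion by the transposition. At a column of the pair the minors
  -- coincide and the position moves by one, which flips the sign. At any other column the position
  -- is fixed and the minor has two adjacent columns swapped, so induction applies.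
  det-swap : (q : Fin n) (M : Matrix (suc n)) →
             det (λ i k → M i (swapAdjacent q ⟨$⟩ʳ k)) ≈ - det M
  det-swap q M = begin
    sum (term M′)                            ≈⟨ sum-cong-≋ pointwise ⟩
    sum (λ j → - term M (swapAdjacent q ⟨$⟩ʳ j))   ≈⟨ sum-neg (λ j → term M (swapAdjacent q ⟨$⟩ʳ j)) ⟩
    - sum (λ j → term M (swapAdjacent q ⟨$⟩ʳ j))   ≈⟨ -‿cong (∑-permute (term M) (swapAdjacent q)) ⟨
    - sum (term M)                           ∎
    where
    M′ : Matrix _
    M′ i k = M i (swapAdjacent q ⟨$⟩ʳ k)

    pointwise : ∀ j → term M′ j ≈ - term M (swapAdjacent q ⟨$⟩ʳ j)
    pointwise j with meets q j
    ... | left rewrite swapAdjacent-inject₁ q = begin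
      (- 1#) ^ toℕ (inject₁ q) * (M zero (suc q) * det (minor M′ (inject₁ q)))
        ≈⟨ *-congˡ (*-congˡ (det-congʳ (M ∘ suc) (swapAdjacent-punchIn-inject₁ q))) ⟩
      (- 1#) ^ toℕ (inject₁ q) * (M zero (suc q) * det (minor M (suc q)))
        ≈⟨ *-congʳ (trans (-‿cong (sign-suc q)) (-‿involutive _)) ⟨
      - ((- 1#) ^ toℕ (suc q)) * (M zero (suc q) * det (minor M (suc q)))
        ≈⟨ -‿distribˡ-* _ _ ⟨
      - term M (suc q) ∎
    ... | right rewrite swapAdjacent-suc q = begin
      (- 1#) ^ toℕ (suc q) * (M zero (inject₁ q) * det (minor M′ (suc q)))
        ≈⟨ *-cong (sign-suc q) (*-congˡ (det-congʳ (M ∘ suc) (swapAdjacent-punchIn-suc q))) ⟩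
      - ((- 1#) ^ toℕ (inject₁ q)) * (M zero (inject₁ q) * det (minor M (inject₁ q)))
        ≈⟨ -‿distribˡ-* _ _ ⟨
      - term M (inject₁ q) ∎
    ... | apart q′ _ _ fixed e rewrite fixed = begin
      (- 1#) ^ toℕ j * (M zero j * det (minor M′ j))
        ≈⟨ *-congˡ (*-congˡ (det-congʳ (M ∘ suc) e)) ⟩
      (- 1#) ^ toℕ j * (M zero j * det (λ i k → minor M j i (swapAdjacent q′ ⟨$⟩ʳ k)))
        ≈⟨ *-congˡ (*-congˡ (det-swap q′ (minor M j))) ⟩
      (- 1#) ^ toℕ j * (M zero j * - det (minor M j))
        ≈⟨ *-congˡ (-‿distribʳ-* _ _) ⟨
      (- 1#) ^ toℕ j * - (M zero j * det (minor M j))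
        ≈⟨ -‿distribʳ-* _ _ ⟨
      - term M j ∎

  -- Column `p` reaches the front through `toℕ p` adjacent transpositions.
  det-cycle : (p : Fin (suc n)) (M : Matrix (suc n)) →
              det (λ i → M i ∘ cycle p) ≈ (- 1#) ^ toℕ p * det M
  det-cycle = <-weakInduction P base step
    where
    P : Fin (suc _) → Set _
    P p = ∀ M → det (λ i → M i ∘ cycle p) ≈ (- 1#) ^ toℕ p * det M

    base : P zero
    base M = trans (det-congʳ M {cycle zero} {λ k → k} λ { zero → ≡.refl ; (suc k) → ≡.refl })
                   (sym (*-identityˡ _))

    step : ∀ q → P (inject₁ q) → P (suc q)
    step q ih M = begin
      det (λ i → M i ∘ cycle (suc q))
        ≈⟨ det-congʳ M (≡.sym ∘ swapAdjacent-cycle q) ⟩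
      det (λ i k → M i (swapAdjacent q ⟨$⟩ʳ cycle (inject₁ q) k))
        ≈⟨ ih (λ i k → M i (swapAdjacent q ⟨$⟩ʳ k)) ⟩
      (- 1#) ^ toℕ (inject₁ q) * det (λ i k → M i (swapAdjacent q ⟨$⟩ʳ k))
        ≈⟨ *-congˡ (det-swap q M) ⟩
      (- 1#) ^ toℕ (inject₁ q) * - det M
        ≈⟨ -‿distribʳ-* _ _ ⟨
      - ((- 1#) ^ toℕ (inject₁ q) * det M)
        ≈⟨ -‿distribˡ-* _ _ ⟩
      - ((- 1#) ^ toℕ (inject₁ q)) * det M
        ≈⟨ *-congʳ (sign-suc q) ⟨
      (- 1#) ^ toℕ (suc q) * det M ∎

  det-equal-head : (k : Fin n) (M : Matrix (suc n)) →
                   (∀ i → M i zero ≈ M i (suc k)) → det M ≈ 0#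
  det-equal-head k M eq = begin
    det M                                      ≈⟨ det-cong (λ i j → reflexive (≡.sym (moved i j))) ⟩
    det (λ i → M′ i ∘ cycle (inject₁ k))       ≈⟨ det-cycle (inject₁ k) M′ ⟩
    (- 1#) ^ toℕ (inject₁ k) * det M′          ≈⟨ *-congˡ (det-adjacent-equal k M′ adjacent) ⟩
    (- 1#) ^ toℕ (inject₁ k) * 0#              ≈⟨ zeroʳ _ ⟩
    0#                                         ∎
    where
    -- Column zero is reinserted just before its copy; `cycle (inject₁ k)` undoes this, so
    -- `det-cycle` relates the two determinants.
    M′ : Matrix _
    M′ i = insertAt (tail (M i)) (inject₁ k) (head (M i))

    moved : ∀ i j → M′ i (cycle (inject₁ k) j) ≡ M i j
    moved i zero    = insertAt-lookup (tail (M i)) (inject₁ k) (head (M i))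
    moved i (suc j) = insertAt-punchIn (tail (M i)) (inject₁ k) (head (M i)) j

    adjacent : ∀ i → M′ i (inject₁ k) ≈ M′ i (suc k)
    adjacent i = begin
      M′ i (inject₁ k)                 ≡⟨ moved i zero ⟩
      M i zero                         ≈⟨ eq i ⟩
      M i (suc k)                      ≡⟨ moved i (suc k) ⟨
      M′ i (punchIn (inject₁ k) k)     ≡⟨ ≡.cong (M′ i) (punchIn-inject₁ k) ⟩
      M′ i (suc k)                     ∎

  -- Linearity in the first column and Cramer's rule

  *-sum-exchange : ∀ {m} (s : Carrier) (g d : Vector Carrier m) →
                   s * sum (λ k → g k * d k) ≈ sum (λ k → g k * (s * d k))
  *-sum-exchange s g d =
    trans (*-distribˡ-sum s (λ k → g k * d k)) (sum-cong-≋ λ k → *S.x∙yz≈y∙xz s (g k) (d k))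

  withHead : (Fin (suc n) → Carrier) → Matrix (suc n) → Matrix (suc n)
  withHead v M i = v i Vector.∷ tail (M i)

  -- Proved together with `term-linear-head`, as the expansion runs along the first row: in the term
  -- of column zero the linear entry is a factor, and in the other terms the first column survives
  -- in the minor, a smaller instance.
  det-linear-head : ∀ {m} (M : Matrix (suc n)) (g : Vector Carrier m)
                    (w : Fin m → Fin (suc n) → Carrier) →
                    (∀ i → M i zero ≈ sum (λ k → g k * w k i)) →
                    det M ≈ sum (λ k → g k * det (withHead (w k) M))

  term-linear-head : ∀ {m} (M : Matrix (suc n)) (g : Vector Carrier m)
                     (w : Fin m → Fin (suc n) → Carrier) →
                     (∀ i → M i zero ≈ sum (λ k → g k * w k i)) →
                     ∀ j → term M j ≈ sum (λ k → g k * term (withHead (w k) M) j)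

  det-linear-head {n} M g w eq = begin
    sum (term M)
      ≈⟨ sum-cong-≋ (term-linear-head M g w eq) ⟩
    sum (λ j → sum λ k → g k * term (withHead (w k) M) j)
      ≈⟨ ∑-comm (λ j k → g k * term (withHead (w k) M) j) ⟩
    sum (λ k → sum λ j → g k * term (withHead (w k) M) j)
      ≈⟨ sum-cong-≋ (λ k → *-distribˡ-sum (g k) (term (withHead (w k) M))) ⟨
    sum (λ k → g k * det (withHead (w k) M)) ∎

  term-linear-head M g w eq zero = begin
    1# * (M zero zero * D)
      ≈⟨ *-congˡ (*-congʳ (eq zero)) ⟩
    1# * (sum (λ k → g k * w k zero) * D)
      ≈⟨ *-congˡ (trans (*-comm _ _) (*-sum-exchange D g (λ k → w k zero))) ⟩
    1# * sum (λ k → g k * (D * w k zero))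
      ≈⟨ *-sum-exchange 1# g (λ k → D * w k zero) ⟩
    sum (λ k → g k * (1# * (D * w k zero)))
      ≈⟨ sum-cong-≋ (λ k → *-congˡ (*-congˡ (*-comm D (w k zero)))) ⟩
    sum (λ k → g k * (1# * (w k zero * D))) ∎
    where D = det (minor M zero)
  term-linear-head {suc n} M g w eq (suc j) = begin
    s * (x * det (minor M (suc j)))
      ≈⟨ *-congˡ (*-congˡ (det-linear-head (minor M (suc j)) g (λ k → w k ∘ suc) (eq ∘ suc))) ⟩
    s * (x * sum (λ k → g k * det (withHead (w k ∘ suc) (minor M (suc j)))))
      ≈⟨ *-congˡ (*-sum-exchange x g (λ k → det (withHead (w k ∘ suc) (minor M (suc j))))) ⟩
    s * sum (λ k → g k * (x * det (withHead (w k ∘ suc) (minor M (suc j)))))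
      ≈⟨ *-sum-exchange s g (λ k → x * det (withHead (w k ∘ suc) (minor M (suc j)))) ⟩
    sum (λ k → g k * (s * (x * det (withHead (w k ∘ suc) (minor M (suc j))))))
      ≈⟨ sum-cong-≋ (λ k → *-congˡ {g k} (*-congˡ {s} (*-congˡ {x} (det-cong (minor-withHead k))))) ⟩
    sum (λ k → g k * term (withHead (w k) M) (suc j)) ∎
    where
    s = (- 1#) ^ toℕ (suc j)
    x = M zero (suc j)

    minor-withHead : ∀ k i l → withHead (w k ∘ suc) (minor M (suc j)) i l ≈
                               minor (withHead (w k) M) (suc j) i l
    minor-withHead k i zero    = refl
    minor-withHead k i (suc l) = refl

  det-zero-head : (M : Matrix (suc n)) → (∀ i → M i zero ≈ 0#) → det M ≈ 0#
  -- A zero column is the empty linear combination.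
  det-zero-head M eq = det-linear-head {m = 0} M (λ ()) (λ ()) eq

  -- Expand the front column by linearity. A term k ≠ p repeats a column that is still present; the
  -- term k = p is `M` with column `p` moved to the front, whence the sign. With the new column in
  -- front, the result is directly the hook alternant, or the first-column reduction in
  -- `vandermonde-suc`.
  cramer : (p : Fin (suc n)) (M : Matrix (suc n)) (g v : Vector Carrier (suc n)) →
           (∀ i → v i ≈ sum (λ k → g k * M i k)) →
           det (λ i → v i Vector.∷ removeAt (M i) p) ≈ (- 1#) ^ toℕ p * (g p * det M)
  cramer p M g v eq = begin
    det (λ i → v i Vector.∷ removeAt (M i) p)
      ≈⟨ det-linear-head (λ i → v i Vector.∷ removeAt (M i) p) g (λ k i → M i k) eq ⟩
    sum (λ k → g k * det (N k))
      ≈⟨ sum-single p (λ k → g k * det (N k))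
           (λ k k≢p → trans (*-congˡ (repeated k≢p)) (zeroʳ (g k))) ⟩
    g p * det (N p)
      ≈⟨ *-congˡ (trans (det-cong N-cycle) (det-cycle p M)) ⟩
    g p * ((- 1#) ^ toℕ p * det M)
      ≈⟨ *S.x∙yz≈y∙xz _ _ _ ⟩
    (- 1#) ^ toℕ p * (g p * det M) ∎
    where
    N : Fin _ → Matrix _
    N k i = M i k Vector.∷ removeAt (M i) p

    repeated : ∀ {k} → k ≢ p → det (N k) ≈ 0#
    repeated {k} k≢p = det-equal-head (punchOut (k≢p ∘ ≡.sym)) (N k) λ i →
      reflexive (≡.cong (M i) (≡.sym (punchIn-punchOut (k≢p ∘ ≡.sym))))

    N-cycle : ∀ i k → N p i k ≈ M i (cycle p k)
    N-cycle i zero    = refl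
    N-cycle i (suc k) = refl

  -- The Vandermonde determinant

  vandermonde : Vector Carrier n → Carrier
  -- For a positive number of points this exponent reduces to that of the denominator in `IsSchur`;
  -- zero points give the base case of `vandermonde#0`.
  vandermonde {n} x = det (powers x λ j → n ∸ suc (toℕ j))

  differences : Carrier → Vector Carrier n → Carrier
  differences y x = product λ j → y - x j

  differences-self : (x : Vector Carrier n) (i : Fin n) → differences (x i) x ≈ 0#
  differences-self x zero    = trans (*-congʳ (-‿inverseʳ _)) (zeroˡ _)
  differences-self x (suc i) = trans (*-congˡ (differences-self (tail x) i)) (zeroʳ _)

  -- Leading coefficient first, in the column order of `vandermonde`, so that coefficients are
  -- column multipliers.
  polynomial : Vector Carrier n → Carrier → Carrier
  polynomial {n} g y = sum λ j → g j * y ^ (n ∸ suc (toℕ j))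

  shift-polynomial : (g : Vector Carrier n) →
                     Σ[ h ∈ Vector Carrier (suc n) ] ∀ y → y * polynomial g y ≈ polynomial h y
  shift-polynomial {zero}  g = (λ _ → 0#) , λ y →
    trans (zeroʳ y) (sym (trans (+-identityʳ _) (zeroˡ _)))
  shift-polynomial {suc n} g with shift-polynomial (tail g)
  ... | h , eq = head g Vector.∷ h , λ y → begin
    y * (head g * y ^ n + polynomial (tail g) y)
      ≈⟨ distribˡ _ _ _ ⟩
    y * (head g * y ^ n) + y * polynomial (tail g) y
      ≈⟨ +-cong (*S.x∙yz≈y∙xz _ _ _) (eq y) ⟩
    head g * (y * y ^ n) + polynomial h y ∎

  -- The coefficients are chosen before y, so one combination of columns works in every row.
  -- Multiplying y ^ n + g by y - x₀ keeps the leading 1; `h` comes from y times g and `h′` from -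
  -- x₀ times the whole.
  differences-monic : (x : Vector Carrier n) →
                      Σ[ g ∈ Vector Carrier n ] ∀ y → differences y x ≈ polynomial (1# Vector.∷ g) y
  differences-monic {zero}  x = (λ ()) , λ y → sym (trans (+-identityʳ _) (*-identityˡ _))
  differences-monic {suc n} x with differences-monic (tail x)
  ... | g , eq with shift-polynomial g
  ... | h , shifted = (λ j → h j + h′ j) , λ y → begin
    (y - x₀) * differences y (tail x)
      ≈⟨ *-congˡ (eq y) ⟩
    (y - x₀) * (1# * y ^ n + polynomial g y)
      ≈⟨ *-congˡ (+-congʳ (*-identityˡ _)) ⟩
    (y - x₀) * (y ^ n + polynomial g y)
      ≈⟨ distribʳ _ _ _ ⟩
    y * (y ^ n + polynomial g y) + - x₀ * (y ^ n + polynomial g y)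
      ≈⟨ +-cong (distribˡ _ _ _) (distribˡ _ _ _) ⟩
    (y * y ^ n + y * polynomial g y) + (- x₀ * y ^ n + - x₀ * polynomial g y)
      ≈⟨ +-cong (+-congˡ (shifted y)) (+-congˡ (scaled y)) ⟩
    (y * y ^ n + polynomial h y) + polynomial h′ y
      ≈⟨ +-assoc _ _ _ ⟩
    y * y ^ n + (polynomial h y + polynomial h′ y)
      ≈⟨ +-cong (sym (*-identityˡ _)) (added y) ⟩
    1# * (y * y ^ n) + polynomial (λ j → h j + h′ j) y ∎
    where
    x₀ = head x

    h′ : Vector Carrier (suc n)
    h′ = - x₀ Vector.∷ λ j → - x₀ * g j

    scaled : ∀ y → - x₀ * polynomial g y ≈ sum λ j → (- x₀ * g j) * y ^ (n ∸ suc (toℕ j))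
    scaled y = trans (*-distribˡ-sum (- x₀) (λ j → g j * y ^ (n ∸ suc (toℕ j))))
                     (sum-cong-≋ λ j → sym (*-assoc (- x₀) (g j) _))

    added : ∀ y → polynomial h y + polynomial h′ y ≈ polynomial (λ j → h j + h′ j) y
    added y = sym (trans (sum-cong-≋ λ j → distribʳ (y ^ (n ∸ toℕ j)) (h j) (h′ j))
                         (∑-distrib-+ (λ j → h j * y ^ (n ∸ toℕ j)) (λ j → h′ j * y ^ (n ∸ toℕ j))))

  -- Column operations turn the first column y ^ n into the monic polynomial with roots
  -- x₁, …, xₙ, which vanishes in every row but the first.
  vandermonde-suc : (x : Vector Carrier (suc n)) →
                    vandermonde x ≈ differences (head x) (tail x) * vandermonde (tail x)
  vandermonde-suc {n} x with differences-monic (tail x)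
  ... | g , eq = begin
    vandermonde x
      ≈⟨ trans (*-identityˡ _) (*-identityˡ _) ⟨
    -- The two factors 1 are the sign (-1)^0 and the leading coefficient, which multiplies column
    -- zero in `cramer zero`.
    1# * (1# * vandermonde x)
      ≈⟨ cramer zero (powers x λ j → n ∸ toℕ j) (1# Vector.∷ g) v (λ i → eq (x i)) ⟨
    det M
      ≈⟨ +-cong (*-identityˡ _) (sum-zero vanishing) ⟩
    differences (head x) (tail x) * vandermonde (tail x) + 0#
      ≈⟨ +-identityʳ _ ⟩
    differences (head x) (tail x) * vandermonde (tail x) ∎
    where
    v : Vector Carrier (suc n)
    v i = differences (x i) (tail x)

    M : Matrix (suc n)
    M i = v i Vector.∷ λ k → x i ^ (n ∸ suc (toℕ k))

    zero-minor : ∀ {n} (M : Matrix (suc n)) → (∀ i → M (suc i) zero ≈ 0#) →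
                 ∀ j → det (minor M (suc j)) ≈ 0#
    zero-minor {suc n} M z j = det-zero-head (minor M (suc j)) z

    vanishing : ∀ j → term M (suc j) ≈ 0#
    vanishing j = trans
      (*-congˡ {(- 1#) ^ toℕ (suc j)}
        (trans (*-congˡ (zero-minor M (differences-self (tail x)) j)) (zeroʳ _)))
      (zeroʳ _)

-- Apartness in K and in K[[t]]

module HeytingFieldProperties {k ℓ₁ ℓ₂} (K : HeytingField k ℓ₁ ℓ₂) where
  open HeytingField K hiding (zero)
  private
    Kring : CommutativeRing k ℓ₁
    Kring = HeytingCommutativeRing.commutativeRing heytingCommutativeRing
  open CommutativeRing Kring using (ring; +-commutativeMonoid)
  open HeytingProperties heytingCommutativeRing
  open RingProperties ring using (-1*x≈-x)
  open MonoidSum +-commutativeMonoid using (sum; sum-remove)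
  open PowerSeries Kring using (Series; _*ₛ_)
  open import Relation.Binary.Reasoning.Setoid setoid

  -- Apartness from 0 is invertibility, and w * x inverts y when w inverts x * y.
  xy#0⇒y#0 : ∀ {x y} → x * y # 0# → y # 0#
  xy#0⇒y#0 {x} {y} xy#0 with #⇒invertible xy#0
  ... | w , w*xy≈1 , _ = invertibleˡ⇒# (w * x , (begin
    w * x * (y - 0#)     ≈⟨ *-congˡ (x-0≈x y) ⟩
    w * x * y            ≈⟨ *-assoc w x y ⟩
    w * (x * y)          ≈⟨ *-congˡ (x-0≈x (x * y)) ⟨
    w * (x * y - 0#)     ≈⟨ w*xy≈1 ⟩
    1#                   ∎))

  xy#0⇒x#0 : ∀ {x y} → x * y # 0# → x # 0#
  xy#0⇒x#0 xy#0 = xy#0⇒y#0 (#-congʳ (*-comm _ _) xy#0)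

  x+y-y≈x : ∀ x y → x + y - y ≈ x
  x+y-y≈x x y = trans (+-assoc _ _ _) (trans (+-congˡ (-‿inverseʳ y)) (+-identityʳ x))

  x#y⇒x-y#0 : ∀ {x y} → x # y → x - y # 0#
  x#y⇒x-y#0 {x} {y} x#y with #⇒invertible x#y
  ... | w , w*[x-y]≈1 , _ = invertibleˡ⇒# (w , trans (*-congˡ (x-0≈x (x - y))) w*[x-y]≈1)

  x+y#0⇒x#0⊎y#0 : ∀ {x y} → x + y # 0# → x # 0# ⊎ y # 0#
  x+y#0⇒x#0⊎y#0 {x} {y} x+y#0 =
    Sum.map₁ (λ x+y#y → #-congʳ (x+y-y≈x x y) (x#y⇒x-y#0 x+y#y)) (#-cotrans x+y#0 y)

  -- Replaces a decision whether x + y vanishes: cotransitivity, in the form of `x+y#0⇒x#0⊎y#0`,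
  -- applied to x = (x + y) + (- y).
  x#0⇒x+y#0⊎y#0 : ∀ {x y} → x # 0# → x + y # 0# ⊎ y # 0#
  x#0⇒x+y#0⊎y#0 {x} {y} x#0 =
    Sum.map₂ (λ -y#0 → xy#0⇒y#0 (#-congʳ (sym (-1*x≈-x y)) -y#0))
             (x+y#0⇒x#0⊎y#0 (#-congʳ (sym (x+y-y≈x x y)) x#0))

  sum#0⇒term#0 : ∀ {n} (t : Vector Carrier n) → sum t # 0# → ∃[ j ] t j # 0#
  sum#0⇒term#0 {zero}  t 0#0 = contradiction 0#0 (#-irrefl refl)
  sum#0⇒term#0 {suc n} t sum#0 with x+y#0⇒x#0⊎y#0 sum#0
  ... | inj₁ head#0 = zero , head#0
  ... | inj₂ tail#0 = Prod.map suc id (sum#0⇒term#0 (tail t) tail#0)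

  -- Without decidable equality the orders of f and g are not available.  Instead, if
  -- the coefficient of f * g at n + m is not known to be nonzero, then another term of
  -- the convolution is, and it provides nonzero coefficients with smaller n + m.
  *ₛ#0 : ∀ (f g : Series) n m → f n # 0# → g m # 0# → ∃[ l ] (f *ₛ g) l # 0#
  *ₛ#0 f g n m = go n m (<-wellFounded (n ℕ.+ m))
    where
    go : ∀ n m → Acc _<_ (n ℕ.+ m) → f n # 0# → g m # 0# → ∃[ l ] (f *ₛ g) l # 0#
    go n m (acc rec) fn#0 gm#0 = split (x#0⇒x+y#0⊎y#0 (x#0y#0→xy#0 fn#0 gm#0))
      where
      n<1+n+m : n < suc (n ℕ.+ m)
      n<1+n+m = s≤s (ℕₚ.m≤m+n n m)

      n′ : Fin (suc (n ℕ.+ m))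
      n′ = fromℕ< n<1+n+m

      toℕ-n′ : toℕ n′ ≡ n
      toℕ-n′ = toℕ-fromℕ< n<1+n+m

      t : Vector Carrier (suc (n ℕ.+ m))
      t j = f (toℕ j) * g (n ℕ.+ m ∸ toℕ j)

      fngm≈tn′ : f n * g m ≈ t n′
      fngm≈tn′ = *-cong (reflexive (≡.cong f (≡.sym toℕ-n′)))
        (reflexive (≡.cong g (≡.sym (≡.trans (≡.cong (n ℕ.+ m ∸_) toℕ-n′) (ℕₚ.m+n∸m≡n n m)))))

      split : f n * g m + sum (removeAt t n′) # 0# ⊎ sum (removeAt t n′) # 0# →
              ∃[ l ] (f *ₛ g) l # 0#
      split (inj₁ total#0) = n ℕ.+ m , #-congʳ
        (trans (+-congʳ fngm≈tn′) (sym (sum-remove {i = n′} t))) total#0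
      split (inj₂ rest#0) with sum#0⇒term#0 (removeAt t n′) rest#0
      ... | j , tj#0 with ℕₚ.<-cmp (toℕ (punchIn n′ j)) n
      -- The new index i is kept with `g m` if i < n. If i > n, the cofactor index n + m - i is
      -- below m and is kept with `f n`. The index n itself was removed.
      ... | tri< i<n _ _ = go _ m (rec (ℕₚ.+-monoˡ-< m i<n)) (xy#0⇒x#0 tj#0) gm#0
      ... | tri≈ _ i≡n _ = contradiction
        (Finₚ.toℕ-injective (≡.trans i≡n (≡.sym toℕ-n′))) (punchInᵢ≢i n′ j)
      ... | tri> _ _ n<i = go n _ (rec (ℕₚ.+-monoʳ-< n i′<m)) fn#0 (xy#0⇒y#0 tj#0)
        where
        i′<m : n ℕ.+ m ∸ toℕ (punchIn n′ j) < m
        i′<m = ≡.subst (n ℕ.+ m ∸ toℕ (punchIn n′ j) <_) (ℕₚ.m+n∸m≡n n m)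
          (ℕₚ.∸-monoʳ-< n<i (ℕ.s≤s⁻¹ (toℕ<n (punchIn n′ j))))

-- Counting walks

length-filter-map : ∀ {a b p q} {A : Set a} {B : Set b} {P : Pred B p} {Q : Pred A q}
                    (P? : Decidable P) (Q? : Decidable Q) (f : A → B) →
                    (∀ x → P (f x) ⇔ Q x) → ∀ xs →
                    length (filter P? (map f xs)) ≡ length (filter Q? xs)
length-filter-map P? Q? f P⇔Q []       = ≡.refl
length-filter-map P? Q? f P⇔Q (x ∷ xs) with P? (f x) | Q? x
... | yes p | yes q = ≡.cong suc (length-filter-map P? Q? f P⇔Q xs)
... | yes p | no ¬q = contradiction (Equivalence.to (P⇔Q x) p) ¬q
... | no ¬p | yes q = contradiction (Equivalence.from (P⇔Q x) q) ¬p
... | no ¬p | no ¬q = length-filter-map P? Q? f P⇔Q xs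

module WalkProperties (a c : ℕ) where
  open Walks a c

  altitudes-start : ∀ {p} {P : Pred ℤ p} k (w : Vec Jump n) → All P (altitudes k w) → P k
  altitudes-start k []      (pk ∷ _) = pk
  altitudes-start k (_ ∷ _) (pk ∷ _) = pk

  -- The starting altitude is a natural number, so prefixing the jump adds no condition to those on
  -- the rest of the walk.
  #meanders-step : ∀ {h h′} j → + h ℤ.+ jump j ≡ + h′ → ∀ i n →
                   length (filter (meanderTo? h i) (map (j ∷_) (allWalks n))) ≡ #meanders h′ i n
  #meanders-step {h} {h′} j step i n =
    length-filter-map (meanderTo? h i) (meanderTo? h′ i) (j ∷_) first-jump (allWalks n)
    where
    first-jump : (w : Vec Jump n) → MeanderTo h i (j ∷ w) ⇔ MeanderTo h′ i w
    first-jump w rewrite step =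
      mk⇔ (λ { (_ ∷ nonneg , end) → nonneg , end })
          (λ { (nonneg , end) → ℤ.+≤+ z≤n ∷ nonneg , end })

  -- The second altitude is already negative, and `altitudes-start` exposes it whatever the rest of
  -- the walk.
  #meanders-nostep : ∀ {h} j → ¬ (+ 0 ℤ.≤ + h ℤ.+ jump j) → ∀ i n →
                     length (filter (meanderTo? h i) (map (j ∷_) (allWalks n))) ≡ 0
  #meanders-nostep {h} j blocked i n =
    ≡.cong length (filter-none (meanderTo? h i) (Allₚ.map⁺ (All.universal stuck (allWalks n))))
    where
    stuck : (w : Vec Jump n) → ¬ MeanderTo h i (j ∷ w)
    stuck w (_ ∷ nonneg , _) = blocked (altitudes-start _ w nonneg)

  #meanders-suc : ∀ h i n → #meanders h i (suc n) ≡
                  length (filter (meanderTo? h i) (map (down ∷_) (allWalks n))) ℕ.+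
                  #meanders (h ℕ.+ c) i n
  #meanders-suc h i n = begin
    length (filter P? (downs ++ ups))
      ≡⟨ ≡.cong length (filter-++ P? downs ups) ⟩
    length (filter P? downs ++ filter P? ups)
      ≡⟨ length-++ (filter P? downs) ⟩
    length (filter P? downs) ℕ.+ length (filter P? ups)
      ≡⟨ ≡.cong (length (filter P? downs) ℕ.+_) (#meanders-step up ≡.refl i n) ⟩
    length (filter P? downs) ℕ.+ #meanders (h ℕ.+ c) i n ∎
    where
    open ≡.≡-Reasoning
    P? : Decidable (MeanderTo h i)
    P?    = meanderTo? h i
    downs ups : List (Vec Jump (suc n))
    downs = map (down ∷_) (allWalks n)
    ups   = map (up ∷_) (allWalks n)

  #meanders-suc-≥ : ∀ {h} → a ≤ h → ∀ i n →
                    #meanders h i (suc n) ≡ #meanders (h ∸ a) i n ℕ.+ #meanders (h ℕ.+ c) i n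
  #meanders-suc-≥ {h} a≤h i n =
    ≡.trans (#meanders-suc h i n) (≡.cong (ℕ._+ #meanders (h ℕ.+ c) i n)
                                       (#meanders-step down step i n))
    where
    step : + h ℤ.+ jump down ≡ + (h ∸ a)
    step = ≡.trans (ℤₚ.m-n≡m⊖n h a) (ℤₚ.⊖-≥ a≤h)

  #meanders-suc-< : ∀ {h} → h < a → ∀ i n →
                    #meanders h i (suc n) ≡ #meanders (h ℕ.+ c) i n
  #meanders-suc-< {h} h<a i n =
    ≡.trans (#meanders-suc h i n) (≡.cong (ℕ._+ #meanders (h ℕ.+ c) i n)
                                       (#meanders-nostep down blocked i n))
    where
    blocked : ¬ (+ 0 ℤ.≤ + h ℤ.+ jump down)
    blocked 0≤h-a = ℕₚ.<⇒≱ h<a (ℤₚ.drop‿+≤+ (ℤₚ.0≤i-j⇒j≤i 0≤h-a))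

  #meanders-zero-≡ : ∀ h → #meanders h h 0 ≡ 1
  #meanders-zero-≡ h =
    ≡.cong length (filter-accept (meanderTo? h h) {x = []} {xs = []} (ℤ.+≤+ z≤n ∷ [] , ≡.refl))

  #meanders-zero-≢ : ∀ {h i} → h ≢ i → #meanders h i 0 ≡ 0
  #meanders-zero-≢ {h} {i} h≢i =
    ≡.cong length (filter-reject (meanderTo? h i) {x = []} {xs = []} (h≢i ∘ ℤₚ.+-injective ∘ proj₂))

-- Generating functions and the kernel equation

module PuiseuxProperties {k ℓ₁ ℓ₂} (K : HeytingField k ℓ₁ ℓ₂) (N : ℕ) .{{_ : NonZero N}} where
  private
    module K = HeytingField K
    Kring : CommutativeRing k ℓ₁
    Kring = HeytingCommutativeRing.commutativeRing K.heytingCommutativeRing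
    module Kr = CommutativeRing Kring
  open Puiseux K N hiding (_^_)
  open CommutativeRing seriesRing
    using (setoid; sym; trans; semiring; +-commutativeMonoid; +-cong; +-congˡ;
           *-congˡ; *-congʳ; +-identityˡ; *-identityˡ; *-identityʳ;
           *-assoc; zeroˡ; distribˡ; distribʳ; *-commutativeSemigroup)
  open SemiringExp semiring using (_^_; ^-homo-*)
  open MonoidSum +-commutativeMonoid using (sum; sum-cong-≋; ∑-distrib-+)
  open SemiringSum semiring using (*-distribˡ-sum)
  open SumProperties +-commutativeMonoid
  open MonoidMult Kr.+-monoid using (×-congˡ; ×-homo-+) renaming (_×_ to _·_)
  private module *S = CommutativeSemigroupProperties *-commutativeSemigroup

  t*-zero : ∀ f → (t * f) 0 K.≈ K.0#
  t*-zero f = K.trans (K.+-identityʳ _) (Kr.zeroˡ _)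

  t*-suc : ∀ f n → (t * f) (suc n) K.≈ f n
  t*-suc f n = K.trans (K.+-cong (Kr.zeroˡ _) (*-identityˡ f n)) (K.+-identityˡ _)

  t^*-< : ∀ m f {n} → n < m → ((t ^ m) * f) n K.≈ K.0#
  t^*-< (suc m) f {zero}  _         = K.trans (*-assoc t (t ^ m) f 0) (t*-zero ((t ^ m) * f))
  t^*-< (suc m) f {suc n} (s≤s n<m) =
    K.trans (*-assoc t (t ^ m) f (suc n)) (K.trans (t*-suc ((t ^ m) * f) n) (t^*-< m f n<m))

  t^*-+ : ∀ m f n → ((t ^ m) * f) (m ℕ.+ n) K.≈ f n
  t^*-+ zero    f n = *-identityˡ f n
  t^*-+ (suc m) f n =
    K.trans (*-assoc t (t ^ m) f (suc (m ℕ.+ n)))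
            (K.trans (t*-suc ((t ^ m) * f) (m ℕ.+ n)) (t^*-+ m f n))

  z#0 : z # 0#
  -- The coefficient of t ^ N at N is 1; the index is written N + 0 to match `t^*-+`.
  z#0 = N ℕ.+ 0 , #-congʳ (K.trans (K.sym (t^*-+ N 1# 0)) (*-identityʳ z (N ℕ.+ 0))) 1#0
    where open HeytingProperties K.heytingCommutativeRing using (#-congʳ; 1#0)

  infix 4 _≈[_]_
  -- Congruence modulo t ^ M, the precision in which the kernel recursion contracts.
  _≈[_]_ : Series → ℕ → Series → Set ℓ₁
  f ≈[ M ] g = ∀ {n} → n < M → f n K.≈ g n

  -- As N ≥ 1, z is a multiple of t and multiplication by it gains at least one coefficient of
  -- precision.
  z*-cong : ∀ {M f g} → f ≈[ M ] g → z * f ≈[ suc M ] z * g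
  z*-cong {M} {f} {g} f≈g {n} n<1+M with N ℕₚ.≤? n
  ... | no  N≰n = K.trans (t^*-< N f (ℕₚ.≰⇒> N≰n)) (K.sym (t^*-< N g (ℕₚ.≰⇒> N≰n)))
  ... | yes N≤n with m , ≡.refl ← ℕₚ.m≤n⇒∃[o]m+o≡n N≤n =
    K.trans (t^*-+ N f m) (K.trans (f≈g m<M) (K.sym (t^*-+ N g m)))
    where
    m<M : m < M
    m<M = ℕₚ.≤-trans (ℕₚ.+-monoˡ-≤ m (>-nonZero⁻¹ N)) (ℕ.s≤s⁻¹ n<1+M)

  constant : ℕ → Series
  constant m zero    = m · K.1#
  constant m (suc _) = K.0#

  constant-0 : constant 0 ≈ 0#
  constant-0 zero    = K.refl
  constant-0 (suc _) = K.refl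

  constant-1 : constant 1 ≈ 1#
  constant-1 zero    = K.+-identityʳ _
  constant-1 (suc _) = K.refl

  generatingFunction-cong : ∀ {f g} → (∀ n → f n ≡ g n) →
                            generatingFunction f ≈ generatingFunction g
  generatingFunction-cong f≡g n with does (N ∣? n)
  ... | true  = ×-congˡ (f≡g (n / N))
  ... | false = K.refl

  generatingFunction-+ : ∀ f g → generatingFunction (λ n → f n ℕ.+ g n) ≈
                                 generatingFunction f + generatingFunction g
  generatingFunction-+ f g n with does (N ∣? n)
  ... | true  = ×-homo-+ K.1# (f (n / N)) (g (n / N))
  ... | false = K.sym (K.+-identityʳ _)

  -- Adding N preserves divisibility by N and raises the quotient by one.
  generatingFunction-shift : ∀ f m → generatingFunction f (N ℕ.+ m) ≡ generatingFunction (f ∘ suc) m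
  generatingFunction-shift f m
    rewrite does-⇔ (mk⇔ (λ d → ∣m+n∣m⇒∣n d ∣-refl) (∣m∣n⇒∣m+n ∣-refl)) (N ∣? (N ℕ.+ m)) (N ∣? m)
          | ≡.trans (+-distrib-/-∣ˡ {N} m {N} ∣-refl) (≡.cong (ℕ._+ m / N) (n/n≡1 N)) = ≡.refl

  generatingFunction-suc : ∀ f → generatingFunction f ≈
                           constant (f 0) + z * generatingFunction (f ∘ suc)
  generatingFunction-suc f n with N ℕₚ.≤? n
  ... | yes N≤n with m , ≡.refl ← ℕₚ.m≤n⇒∃[o]m+o≡n N≤n = begin
    generatingFunction f (N ℕ.+ m)
      ≡⟨ generatingFunction-shift f m ⟩
    generatingFunction (f ∘ suc) m
      ≈⟨ t^*-+ N (generatingFunction (f ∘ suc)) m ⟨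
    (z * generatingFunction (f ∘ suc)) (N ℕ.+ m)
      ≈⟨ K.+-identityˡ _ ⟨
    K.0# K.+ (z * generatingFunction (f ∘ suc)) (N ℕ.+ m)
      ≈⟨ K.+-cong (constant-positive (ℕₚ.≤-trans (>-nonZero⁻¹ N) (ℕₚ.m≤m+n N m))) K.refl ⟨
    (constant (f 0) + z * generatingFunction (f ∘ suc)) (N ℕ.+ m) ∎
    where
    open import Relation.Binary.Reasoning.Setoid Kr.setoid
    constant-positive : ∀ {n} → 0 < n → constant (f 0) n K.≈ K.0#
    constant-positive (s≤s _) = K.refl
  generatingFunction-suc f n | no N≰n = K.trans (below n (ℕₚ.≰⇒> N≰n))
    (K.trans (K.sym (K.+-identityʳ _))
             (K.+-cong K.refl (K.sym (t^*-< N (generatingFunction (f ∘ suc)) (ℕₚ.≰⇒> N≰n)))))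
    where
    -- The only multiple of N below N is 0.
    below : ∀ n → n < N → generatingFunction f n K.≈ constant (f 0) n
    below zero    _ rewrite dec-true (N ∣? 0) (N ∣0) = ×-congˡ (≡.cong f (0/n≡0 N))
    below (suc n) n<N rewrite dec-false (N ∣? suc n) (>⇒∤ n<N) = K.refl

  module _ {a : ℕ} (x : Series) where

    -- The truncation Σ_{e<a} F_e x^e of a walk generating function in two variables,
    -- with the exponents in decreasing order.
    truncated : (Fin a → ℕ → ℕ) → Series
    truncated φ = sum λ j → generatingFunction (φ j) * x ^ toℕ (opposite j)

    truncated-cong : ∀ {φ ψ} → (∀ j n → φ j n ≡ ψ j n) → truncated φ ≈ truncated ψ
    truncated-cong φ≡ψ = sum-cong-≋ λ j → *-congʳ (generatingFunction-cong (φ≡ψ j))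

    truncated-+ : ∀ φ ψ → truncated (λ j n → φ j n ℕ.+ ψ j n) ≈ truncated φ + truncated ψ
    truncated-+ φ ψ = trans
      (sum-cong-≋ λ j → trans (*-congʳ (generatingFunction-+ (φ j) (ψ j)))
                              (distribʳ (x ^ toℕ (opposite j))
                                        (generatingFunction (φ j)) (generatingFunction (ψ j))))
      (∑-distrib-+ (λ j → generatingFunction (φ j) * x ^ toℕ (opposite j))
                   (λ j → generatingFunction (ψ j) * x ^ toℕ (opposite j)))

    truncated-suc : ∀ φ → truncated φ ≈
      sum (λ j → constant (φ j 0) * x ^ toℕ (opposite j)) + z * truncated (λ j → φ j ∘ suc)
    truncated-suc φ = begin
      truncated φ
        ≈⟨ sum-cong-≋ (λ j → begin
             generatingFunction (φ j) * e j                        ≈⟨ *-congʳ (generatingFunction-suc (φ j)) ⟩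
             (constant (φ j 0) + z * F j) * e j                    ≈⟨ distribʳ (e j) (constant (φ j 0)) (z * F j) ⟩
             constant (φ j 0) * e j + z * F j * e j                ≈⟨ +-congˡ (*-assoc z (F j) (e j)) ⟩
             constant (φ j 0) * e j + z * (F j * e j)              ∎) ⟩
      sum (λ j → constant (φ j 0) * e j + z * (F j * e j))
        ≈⟨ ∑-distrib-+ (λ j → constant (φ j 0) * e j) (λ j → z * (F j * e j)) ⟩
      sum (λ j → constant (φ j 0) * e j) + sum (λ j → z * (F j * e j))
        ≈⟨ +-congˡ (*-distribˡ-sum z (λ j → F j * e j)) ⟨
      sum (λ j → constant (φ j 0) * e j) + z * sum (λ j → F j * e j) ∎
      where
      open import Relation.Binary.Reasoning.Setoid setoid
      F e : Fin a → Series
      F j = generatingFunction (φ j ∘ suc)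
      e j = x ^ toℕ (opposite j)

  -- The kernel method at a single root

  module KernelMethod {a c : ℕ} (x : Series) (kernel : x ^ a ≈ z * (1# + x ^ (a ℕ.+ c))) where
    open Walks a c
    open WalkProperties a c
    open import Relation.Binary.Reasoning.Setoid setoid

    count : ℕ → Fin a → ℕ → ℕ
    count h j = #meanders h (toℕ (opposite j))

    lowPart : ℕ → Series
    lowPart h = truncated {a} x (count h)

    emptyWalk : ℕ → Series
    emptyWalk h = sum λ j → constant (count h j 0) * x ^ toℕ (opposite j)

    absent : ∀ {h} {j : Fin a} → h ≢ toℕ (opposite j) →
             constant (count h j 0) * x ^ toℕ (opposite j) ≈ 0#
    absent {h} {j} h≢e = begin
      constant (count h j 0) * x ^ toℕ (opposite j)
        ≡⟨ ≡.cong (λ m → constant m * x ^ toℕ (opposite j)) (#meanders-zero-≢ h≢e) ⟩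
      constant 0 * x ^ toℕ (opposite j)
        ≈⟨ *-congʳ constant-0 ⟩
      0# * x ^ toℕ (opposite j)
        ≈⟨ zeroˡ _ ⟩
      0# ∎

    -- The empty walk ends at h, above every exponent kept in the truncation.
    emptyWalk-≥ : ∀ {h} → a ≤ h → emptyWalk h ≈ 0#
    emptyWalk-≥ {h} a≤h = sum-zero λ j → absent {h} {j} λ where
      ≡.refl → ℕₚ.<⇒≱ (toℕ<n (opposite j)) a≤h


    emptyWalk-at : (p : Fin a) → emptyWalk (toℕ (opposite p)) ≈ x ^ toℕ (opposite p)
    emptyWalk-at p = begin
      emptyWalk (toℕ (opposite p))
        ≈⟨ sum-single p (λ j → constant (count (toℕ (opposite p)) j 0) * x ^ toℕ (opposite j))
                      (λ j j≢p → absent {toℕ (opposite p)} {j} (j≢p ∘ ≡.sym ∘ opposite-injective)) ⟩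
      constant (count (toℕ (opposite p)) p 0) * x ^ toℕ (opposite p)
        ≡⟨ ≡.cong (λ m → constant m * x ^ toℕ (opposite p)) (#meanders-zero-≡ (toℕ (opposite p))) ⟩
      constant 1 * x ^ toℕ (opposite p)
        ≈⟨ *-congʳ {x ^ toℕ (opposite p)} constant-1 ⟩
      1# * x ^ toℕ (opposite p)
        ≈⟨ *-identityˡ (x ^ toℕ (opposite p)) ⟩
      x ^ toℕ (opposite p) ∎
      where
      opposite-injective : ∀ {i j : Fin a} → toℕ (opposite i) ≡ toℕ (opposite j) → i ≡ j
      opposite-injective {i} {j} eq = ≡.trans (≡.sym (opposite-involutive i))
        (≡.trans (≡.cong opposite (Finₚ.toℕ-injective eq)) (opposite-involutive j))

    emptyWalk-< : ∀ {h} → h < a → emptyWalk h ≈ x ^ h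
    emptyWalk-< h<a = ≡.subst (λ m → emptyWalk m ≈ x ^ m)
      (≡.trans (≡.cong toℕ (opposite-involutive (fromℕ< h<a))) (toℕ-fromℕ< h<a))
      (emptyWalk-at (opposite (fromℕ< h<a)))

    -- The kernel equation times x ^ h. For h ≥ a the summand x ^ h is x ^ ((h - a) + a), matching a
    -- down jump; for h < a it matches the empty walk.
    root-step : ∀ h → x ^ (h ℕ.+ a) ≈ z * (x ^ h + x ^ (h ℕ.+ c ℕ.+ a))
    root-step h = begin
      x ^ (h ℕ.+ a)
        ≈⟨ ^-homo-* x h a ⟩
      x ^ h * x ^ a
        ≈⟨ *-congˡ {x ^ h} kernel ⟩
      x ^ h * (z * (1# + x ^ (a ℕ.+ c)))
        ≈⟨ *S.x∙yz≈y∙xz (x ^ h) z _ ⟩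
      z * (x ^ h * (1# + x ^ (a ℕ.+ c)))
        ≈⟨ *-congˡ {z} (distribˡ (x ^ h) 1# (x ^ (a ℕ.+ c))) ⟩
      z * (x ^ h * 1# + x ^ h * x ^ (a ℕ.+ c))
        ≈⟨ *-congˡ {z} (+-cong (*-identityʳ (x ^ h)) (sym (^-homo-* x h (a ℕ.+ c)))) ⟩
      z * (x ^ h + x ^ (h ℕ.+ (a ℕ.+ c)))
        ≡⟨ ≡.cong (λ m → z * (x ^ h + x ^ m)) exponent ⟩
      z * (x ^ h + x ^ (h ℕ.+ c ℕ.+ a)) ∎
      where
      exponent : h ℕ.+ (a ℕ.+ c) ≡ h ℕ.+ c ℕ.+ a
      exponent = ≡.trans (≡.cong (h ℕ.+_) (ℕₚ.+-comm a c)) (≡.sym (ℕₚ.+-assoc h c a))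

    lowPart-≥ : ∀ {h} → a ≤ h → lowPart h ≈
                  z * lowPart (h ∸ a) + z * lowPart (h ℕ.+ c)
    lowPart-≥ {h} a≤h = begin
      lowPart h
        ≈⟨ truncated-suc {a} x (count h) ⟩
      emptyWalk h + z * truncated {a} x (λ j → count h j ∘ suc)
        ≈⟨ +-cong (emptyWalk-≥ a≤h)
                  (*-congˡ {z} (truncated-cong {a} x λ j → #meanders-suc-≥ a≤h (toℕ (opposite j)))) ⟩
      0# + z * truncated {a} x (λ j n → count (h ∸ a) j n ℕ.+ count (h ℕ.+ c) j n)
        ≈⟨ +-identityˡ _ ⟩
      z * truncated {a} x (λ j n → count (h ∸ a) j n ℕ.+ count (h ℕ.+ c) j n)
        ≈⟨ *-congˡ {z} (truncated-+ {a} x (count (h ∸ a)) (count (h ℕ.+ c))) ⟩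
      z * (lowPart (h ∸ a) + lowPart (h ℕ.+ c))
        ≈⟨ distribˡ z (lowPart (h ∸ a)) (lowPart (h ℕ.+ c)) ⟩
      z * lowPart (h ∸ a) + z * lowPart (h ℕ.+ c) ∎

    lowPart-< : ∀ {h} → h < a → lowPart h ≈
                  x ^ h + z * lowPart (h ℕ.+ c)
    lowPart-< {h} h<a = begin
      lowPart h
        ≈⟨ truncated-suc {a} x (count h) ⟩
      emptyWalk h + z * truncated {a} x (λ j → count h j ∘ suc)
        ≈⟨ +-cong (emptyWalk-< h<a)
                  (*-congˡ {z} (truncated-cong {a} x λ j → #meanders-suc-< h<a (toℕ (opposite j)))) ⟩
      x ^ h + z * lowPart (h ℕ.+ c) ∎

    -- Induction is on the precision, since up jumps raise the altitude. Both sides are z times a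
    -- series, so agreement of these series modulo t ^ M suffices. Precision 0 is vacuous.
    kernel-solution-mod : ∀ M h → z * lowPart h ≈[ M ] x ^ (h ℕ.+ a)
    kernel-solution-mod (suc M) h {n} n<1+M =
      K.trans (z*-cong first-step n<1+M) (K.sym (root-step h n))
      where
      first-step : lowPart h ≈[ M ] x ^ h + x ^ (h ℕ.+ c ℕ.+ a)
      first-step {n} n<M with a ℕₚ.≤? h
      ... | yes a≤h = K.trans (lowPart-≥ a≤h n) (K.+-cong
        (≡.subst (λ m → (z * lowPart (h ∸ a)) n K.≈ (x ^ m) n) (ℕₚ.m∸n+n≡m a≤h)
                 (kernel-solution-mod M (h ∸ a) n<M))
        (kernel-solution-mod M (h ℕ.+ c) n<M))
      ... | no  a≰h = K.trans (lowPart-< (ℕₚ.≰⇒> a≰h) n)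
        (K.+-cong K.refl (kernel-solution-mod M (h ℕ.+ c) n<M))

    kernel-solution : ∀ h → z * lowPart h ≈ x ^ (h ℕ.+ a)
    -- The coefficient at n is determined modulo t ^ (n + 1).
    kernel-solution h n = kernel-solution-mod (suc n) h ℕₚ.≤-refl

-- The linear system at the small roots

-- Column suc k of the numerator has exponent n ∸ toℕ (punchIn p k), as adding 1 to the
-- first toℕ p exponents turns n - 1, …, 0 into n, …, 0 without n ∸ toℕ p.
hook-exponent : ∀ {n} (p : Fin (suc n)) i (k : Fin n) →
                (replicate (toℕ p) 1 ++ replicate i 0) ‼ toℕ k ℕ.+ (n ∸ suc (toℕ k)) ≡
                n ∸ toℕ (punchIn p k)
hook-exponent zero i k = ≡.cong (ℕ._+ _) (zeros i (toℕ k))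
  where
  zeros : ∀ i k → replicate i 0 ‼ k ≡ 0
  zeros zero    k       = ≡.refl
  zeros (suc i) zero    = ≡.refl
  zeros (suc i) (suc k) = zeros i k
hook-exponent (suc p) i zero    = ≡.refl
hook-exponent (suc p) i (suc k) = hook-exponent p i k

-- Nonvanishing of the Vandermonde determinant

module VandermondeApartness {k ℓ₁ ℓ₂} (K : HeytingField k ℓ₁ ℓ₂) (N : ℕ) .{{_ : NonZero N}} where
  private
    module K = HeytingField K
  open Puiseux K N
  open DeterminantProperties seriesRing
  open HeytingFieldProperties K using (*ₛ#0; x#y⇒x-y#0)
  open HeytingProperties K.heytingCommutativeRing using (#-congʳ; 1#0)
  open CommutativeRing seriesRing using (_-_)

  *#0 : ∀ {f g} → f # 0# → g # 0# → f * g # 0#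
  *#0 {f} {g} (n , fn#0) (m , gm#0) = *ₛ#0 f g n m fn#0 gm#0

  differences#0 : ∀ {n} y (x : Vector Series n) → (∀ j → y # x j) → differences y x # 0#
  differences#0 {zero}  y x y#x = 0 , 1#0
  differences#0 {suc n} y x y#x =
    *#0 {y - x zero} {differences y (tail x)}
        (Prod.map₂ x#y⇒x-y#0 (y#x zero)) (differences#0 y (tail x) (y#x ∘ suc))

  -- The product formula, splitting off one point at a time by `vandermonde-suc`; `*#0` is the
  -- positive form of having no zero divisors.
  vandermonde#0 : ∀ {n} (x : Vector Series n) → (∀ {i j} → i ≢ j → x i # x j) → vandermonde x # 0#
  vandermonde#0 {zero}  x distinct = 0 , 1#0
  vandermonde#0 {suc n} x distinct = Prod.map₂ (λ {l} → #-congʳ (K.sym (vandermonde-suc x l)))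
    (*#0 {differences (head x) (tail x)} {vandermonde (tail x)}
         (differences#0 (head x) (tail x) λ j → distinct λ ())
         (vandermonde#0 (tail x) λ i≢j → distinct (i≢j ∘ Finₚ.suc-injective)))

lemma8p3 : ∀ {k ℓ₁ ℓ₂} (K : HeytingField k ℓ₁ ℓ₂)
    (N : ℕ) .{{_ : NonZero N}} →
    let open Puiseux K N in
    (a c h : ℕ) .{{_ : NonZero a}} .{{_ : NonZero c}} → a ≤ h →
    (u : Vector Series a) → SmallRoots a c u →
    (i : Fin a) →
    ∃[ s ] IsSchur (hook h i) u s
    × meanderGF a c h (toℕ i) ≈ (- 1#) ^ (a ∸ toℕ i ∸ 1) * s ÷ z
lemma8p3 K N (suc n) c h a≤h u roots i =
  -- The witness is the claimed formula solved for the Schur value, so the second component only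
  -- cancels two equal signs; the content lies in `schur`.
  s , (vandermonde#0 u distinct , schur) , (z#0 , sym (sign-involutive m (F * z)))
  where
  open Puiseux K N
  open SmallRoots roots
  open PuiseuxProperties K N
  open Determinant seriesRing using (Matrix; det; powers)
  open DeterminantProperties seriesRing
  open VandermondeApartness K N
  open CommutativeRing seriesRing
    using (setoid; sym; semiring; +-commutativeMonoid; reflexive; *-congˡ; *-congʳ; *-comm; *-assoc)
  open MonoidSum +-commutativeMonoid using (sum; sum-cong-≋)
  open SemiringSum semiring using (*-distribˡ-sum)
  open Walks (suc n) c using (#meanders)
  open import Relation.Binary.Reasoning.Setoid setoid

  -- Exponents decrease along the columns of `M`, so this is the column of exponent i; its position
  -- is the power of -1 in the claim.
  p : Fin (suc n)
  p = opposite i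

  m : ℕ
  m = suc n ∸ toℕ i ∸ 1

  toℕ-p : toℕ p ≡ m
  toℕ-p = ≡.trans (opposite-prop i)
    (≡.trans (≡.cong (suc n ∸_) (ℕₚ.+-comm 1 (toℕ i))) (≡.sym (ℕₚ.∸-+-assoc (suc n) (toℕ i) 1)))

  F s : Series
  F = meanderGF (suc n) c h (toℕ i)
  s = (- 1#) ^ m * (F * z)

  M : Matrix (suc n)
  M = powers u (λ j → n ∸ toℕ j)

  -- zF_e for the exponents e = n, …, 0 of the columns of M.
  g : Vector Series (suc n)
  g j = z * generatingFunction (#meanders h (toℕ (opposite j)))

  -- The exponents h + n + 1, then n, ..., 0 without i, are the hook partition plus the staircase n,
  -- ..., 0.
  numerator : Matrix (suc n)
  numerator r = u r ^ (h ℕ.+ suc n) Vector.∷ removeAt (M r) p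

  linear-system : ∀ r → u r ^ (h ℕ.+ suc n) ≈ sum (λ j → g j * M r j)
  linear-system r = begin
    u r ^ (h ℕ.+ suc n)
      ≈⟨ KernelMethod.kernel-solution {suc n} {c} (u r) (kernel r) h ⟨
    z * sum (λ j → G j * u r ^ toℕ (opposite j))
      ≈⟨ *-distribˡ-sum z (λ j → G j * u r ^ toℕ (opposite j)) ⟩
    sum (λ j → z * (G j * u r ^ toℕ (opposite j)))
      ≈⟨ sum-cong-≋ (λ j → sym (*-assoc z (G j) (u r ^ toℕ (opposite j)))) ⟩
    sum (λ j → g j * u r ^ toℕ (opposite j))
      ≈⟨ sum-cong-≋ (λ j → *-congˡ {g j} (reflexive (≡.cong (u r ^_) (opposite-prop j)))) ⟩
    sum (λ j → g j * M r j) ∎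
    where
    G : Vector Series (suc n)
    G j = generatingFunction (#meanders h (toℕ (opposite j)))

  numerator-entry : ∀ r j →
    numerator r j ≈ powers u (λ j → Partition.part (hook h i) j ℕ.+ (n ∸ toℕ j)) r j
  -- First hook part h + 1 plus top staircase exponent n.
  numerator-entry r zero    = reflexive (≡.cong (u r ^_) (ℕₚ.+-suc h n))
  numerator-entry r (suc k) = reflexive (≡.cong (u r ^_) (≡.sym
    (≡.subst (λ q → (replicate q 1 ++ replicate (toℕ i) 0) ‼ toℕ k ℕ.+ (n ∸ suc (toℕ k)) ≡
                    n ∸ toℕ (punchIn p k))
             toℕ-p (hook-exponent p (toℕ i) k))))

  schur : s * det M ≈ det (powers u λ j → Partition.part (hook h i) j ℕ.+ (n ∸ toℕ j))
  schur = begin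
    (- 1#) ^ m * (F * z) * det M
      ≈⟨ *-assoc ((- 1#) ^ m) (F * z) (det M) ⟩
    (- 1#) ^ m * (F * z * det M)
      ≈⟨ *-congˡ {(- 1#) ^ m} (*-congʳ {det M} (*-comm F z)) ⟩
    (- 1#) ^ m * (z * F * det M)
      -- Since `opposite` is an involution, the coefficient of column `p` is z times the series for
      -- final altitude i.
      ≡⟨ ≡.cong₂ (λ m e → (- 1#) ^ m * (z * generatingFunction (#meanders h (toℕ e)) * det M))
                 toℕ-p (opposite-involutive i) ⟨
    (- 1#) ^ toℕ p * (g p * det M)
      ≈⟨ cramer p M g (λ r → u r ^ (h ℕ.+ suc n)) linear-system ⟨
    det numerator
      ≈⟨ det-cong numerator-entry ⟩
    det (powers u λ j → Partition.part (hook h i) j ℕ.+ (n ∸ toℕ j)) ∎
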